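{- For all integers $k,n\geq 0$, the set $\mathcal{C}_{(k)}\cap\mathrm{DP}_n$ is $n$-opposite to itself.
   Context: Partitions are identified up to trailing zeros; $\ell(\gamma)$ is the number of nonzero parts, $|\gamma|$ the sum of parts; the diagram of $\gamma$ is $\{(i,j):1\leq i\leq\ell(\gamma),1\leq j\leq\gamma_i\}$. For a cell $c=(i,j)$, $\mathrm{arm}(c)=\gamma_i-j$, $\mathrm{leg}(c)=\gamma'_j-i$ ($\gamma'$ the conjugate). $\mathrm{dinv}(\gamma)$ is the number of cells with $\mathrm{arm}(c)-\mathrm{leg}(c)\in\{0,1\}$. $\gamma\in\mathrm{DP}_n$ (Dyck partition of order $n$) means the diagram of $\gamma$ is contained in that of $(n-1,n-2,\ldots,1,0)$; for such $\gamma$, $\mathrm{area}_n(\gamma)=\binom{n}{2}-|\gamma|$. Two subsets $B,C\subseteq\mathrm{DP}_n$ are $n$-opposite if there is a unique bijection $g:B\to C$ with $\mathrm{area}_n(\gamma)=\mathrm{dinv}(g(\gamma))$ and $\mathrm{dinv}(\gamma)=\mathrm{area}_n(g(\gamma))$ for all $\gamma\in B$ (with $B=C$ allowed). If $\gamma_1\leq\ell(\gamma)+2$, $\nu(\gamma)=(\ell(\gamma)+1,\gamma_1-1,\ldots,\gamma_{\ell(\gamma)}-1)$. For integers $j$ and $\ell>0$, $r_{j,\ell}=j-\ell\lfloor j/\ell\rfloor$. For $k\geq0,\ell>0$, $\mathbb{I}_{k,\ell}=(\underline{\ell}^{1+\lfloor k/\ell\rfloor},\ell-1,\ell-2,\ldots,1)+(\underline{0}^{1+\lfloor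 k/\ell\rfloor},\underline{1}^{r_{k,\ell}},\underline{0}^{\ell-1-r_{k,\ell}})$ (where $\underline{c}^d$ denotes $d$ copies of $c$ and sequences are added entrywise after padding with zeros), and $\mathbb{I}_{0,0}=(0)$. Define $\mathcal{C}_{(k)}=\bigcup_{\ell=\min(1,k)}^{\infty}\{\nu^m(\mathbb{I}_{k,\ell}):0\leq m\leq\ell\}$. -}

module Defs where

open import Data.Nat using (ℕ; zero; suc; _+_; _∸_; _≤_; _<_; _≤ᵇ_; _≡ᵇ_; _%_; _/_; _⊓_)
open import Data.Nat.Combinatorics using (_C_)
open import Data.Bool using (Bool; true; false; if_then_else_; _∨_)
open import Data.List using (List; []; _∷_; length; map; replicate; _++_; applyUpTo)
open import Data.Nat.ListAction using (sum)
open import Data.Maybe using (Maybe; just; nothing; _>>=_)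
open import Data.Product using (Σ; _×_; ∃; ∃-syntax)
open import Data.Unit using (⊤)
open import Relation.Binary.PropositionalEquality using (_≡_)

-- Partitions are represented canonically as weakly decreasing lists of
-- positive naturals (i.e. with trailing zeros removed).

strip : List ℕ → List ℕ
strip [] = []
strip (x ∷ xs) with strip xs
... | [] = if x ≡ᵇ 0 then [] else x ∷ []
... | y ∷ ys = x ∷ y ∷ ys

conjAt : List ℕ → ℕ → ℕ
conjAt [] j = 0
conjAt (x ∷ xs) j = (if j ≤ᵇ x then 1 else 0) + conjAt xs j

count : (ℕ → Bool) → ℕ → ℕ
count p zero = 0
count p (suc m) = count p m + (if p (suc m) then 1 else 0)

-- for cell (i,j) of γ with row length x: arm - leg ∈ {0,1}
cellOK : List ℕ → ℕ → ℕ → ℕ → Bool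
cellOK γ i x j = let a = x ∸ j ; l = conjAt γ j ∸ i in (a ≡ᵇ l) ∨ (a ≡ᵇ suc l)

dinvRows : List ℕ → ℕ → List ℕ → ℕ
dinvRows γ i [] = 0
dinvRows γ i (x ∷ xs) = count (cellOK γ i x) x + dinvRows γ (suc i) xs

dinv : List ℕ → ℕ
dinv γ = dinvRows γ 1 γ

-- diagram contained in that of (m-1, m-2, ..., 1, 0)
DPfrom : ℕ → List ℕ → Set
DPfrom m [] = ⊤
DPfrom m (x ∷ xs) = (x ≤ m ∸ 1) × DPfrom (m ∸ 1) xs

DP : ℕ → List ℕ → Set
DP n γ = DPfrom n γ

area : ℕ → List ℕ → ℕ
area n γ = (n C 2) ∸ sum γ

ν : List ℕ → Maybe (List ℕ)
ν [] = just (1 ∷ [])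
ν (x ∷ xs) = if x ≤ᵇ (length (x ∷ xs) + 2)
             then just (strip (suc (length (x ∷ xs)) ∷ map (λ y → y ∸ 1) (x ∷ xs)))
             else nothing

νIter : ℕ → List ℕ → Maybe (List ℕ)
νIter zero γ = just γ
νIter (suc m) γ = νIter m γ >>= ν

-- 𝕀_{k,ℓ}; the ℓ = 0 case is 𝕀_{0,0} = (0) (the empty partition)
𝕀 : ℕ → ℕ → List ℕ
𝕀 k zero = []
𝕀 k (suc l) =
  replicate (suc (k / suc l)) (suc l)
  ++ applyUpTo (λ t → (suc l ∸ suc t) + (if suc t ≤ᵇ (k % suc l) then 1 else 0)) l

InC : ℕ → List ℕ → Set
InC k γ = ∃[ ℓ ] ∃[ m ] ((1 ⊓ k ≤ ℓ) × (m ≤ ℓ) × (νIter m (𝕀 k ℓ) ≡ just γ))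

CDP : ℕ → ℕ → List ℕ → Set
CDP k n γ = InC k γ × DP n γ

IsOppMap : ℕ → (List ℕ → Set) → (List ℕ → Set) → (List ℕ → List ℕ) → Set
IsOppMap n B D g =
  (∀ γ → B γ → D (g γ))
  × (∀ γ δ → B γ → B δ → g γ ≡ g δ → γ ≡ δ)
  × (∀ δ → D δ → ∃[ γ ] (B γ × g γ ≡ δ))
  × (∀ γ → B γ → (area n γ ≡ dinv (g γ)) × (dinv γ ≡ area n (g γ)))

Opposite : ℕ → (List ℕ → Set) → (List ℕ → Set) → Set
Opposite n B D = ∃[ g ] (IsOppMap n B D g
  × (∀ h → IsOppMap n B D h → ∀ γ → B γ → h γ ≡ g γ))

{-# OPTIONS --safe #-}
module Submission where

-- Along 𝒞_(k) one has |γ| = k + dinv γ, and dinv takes each value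
-- d = ℓ(ℓ+1)/2 + m with m ≤ ℓ exactly once, at ν^m(𝕀_{k,ℓ}): both |γ| and dinv γ
-- grow by 1 under ν. Hence area_n + dinv is constant on 𝒞_(k) ∩ DP_n, and the only
-- candidate for the bijection sends γ to the member of the chain whose dinv is
-- area_n(γ). It preserves DP_n because ν^m(𝕀_{k,ℓ}) lies in DP_n precisely when
-- k + m ≤ ℓ(n - 1 - ℓ), a condition that is invariant under exchanging dinv and area_n.

open import Defs
open import Data.Bool using (Bool; true; false; if_then_else_; _∨_)
open import Data.Empty using (⊥-elim)
open import Data.List using (List; []; _∷_; length; map; replicate; _++_; applyUpTo)
open import Data.Maybe using (just; fromMaybe; _>>=_)
open import Data.Maybe.Properties using (just-injective)
open import Data.Nat using (ℕ; zero; suc; _+_; _*_; _∸_; _≤_; _<_; _≤ᵇ_; _<ᵇ_; _≡ᵇ_; _%_; _/_; _⊓_; _<?_; z≤n; s≤s; s≤s⁻¹)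
open import Data.Nat.Combinatorics using (_C_; nC1≡n; nCk+nC[k+1]≡[n+1]C[k+1])
open import Data.Nat.DivMod using (m≡m%n+[m/n]*n; m%n<n)
open import Data.Nat.ListAction using (sum)
open import Data.Nat.Properties
open import Data.Nat.Tactic.RingSolver using (solve-∀)
open import Data.Product using (_×_; _,_; proj₁; proj₂; ∃-syntax)
open import Data.Sum using (inj₁; inj₂)
open import Data.Unit using (tt)
open import Function using (_∘_)
open import Relation.Binary.PropositionalEquality using (_≡_; refl; sym; trans; cong; cong₂; subst; module ≡-Reasoning)
open import Relation.Nullary using (yes; no)

-- `ν` trades the first column of γ for a new first row and leaves the arm and leg of every other
-- cell alone. The lost column contributes to dinv the rows with γ_i + i on the levels ℓ(γ)+1 and
-- ℓ(γ)+2, the new row contributes columns on the same two levels, and the boundary path of γ, drawn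
-- up to level ℓ(γ)+2, crosses each of them once more by columns than by rows. One of the two
-- surplus columns is the deleted one, so dinv grows by 1. The containment criterion comes from
-- lengths: for m < ℓ, ν^m(𝕀_{k,ℓ}) has ℓ + ⌊(k+m)/ℓ⌋ parts and the next first row is one longer.
-- That row is the binding constraint, and ⌊(k+m)/ℓ⌋ < n-1-ℓ amounts to k + m + 1 ≤ ℓ(n-1-ℓ). To
-- know these lengths, the induction along the chain carries the heights of those columns of 𝕀 that
-- `ν` has not yet deleted.

⟦_⟧ : Bool → ℕ
⟦ b ⟧ = if b then 1 else 0

⟦⟧≤1 : ∀ b → ⟦ b ⟧ ≤ 1
⟦⟧≤1 true  = ≤-refl
⟦⟧≤1 false = z≤n

<⇒<ᵇ-true : ∀ {m n} → m < n → (m <ᵇ n) ≡ true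
<⇒<ᵇ-true {zero}  (s≤s _) = refl
<⇒<ᵇ-true {suc m} (s≤s p) = <⇒<ᵇ-true p

≥⇒<ᵇ-false : ∀ {m n} → n ≤ m → (m <ᵇ n) ≡ false
≥⇒<ᵇ-false {n = zero}  _       = refl
≥⇒<ᵇ-false {n = suc n} (s≤s p) = ≥⇒<ᵇ-false p

<ᵇ-suc : ∀ m n → (m <ᵇ suc n) ≡ (m ≤ᵇ n)
<ᵇ-suc zero    n = refl
<ᵇ-suc (suc m) n = refl

≤⇒≤ᵇ-true : ∀ {m n} → m ≤ n → (m ≤ᵇ n) ≡ true
≤⇒≤ᵇ-true {m} {n} p = trans (sym (<ᵇ-suc m n)) (<⇒<ᵇ-true (s≤s p))

≡ᵇ-refl : ∀ n → (n ≡ᵇ n) ≡ true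
≡ᵇ-refl zero    = refl
≡ᵇ-refl (suc n) = ≡ᵇ-refl n

≡ᵇ-sym : ∀ m n → (m ≡ᵇ n) ≡ (n ≡ᵇ m)
≡ᵇ-sym zero    zero    = refl
≡ᵇ-sym zero    (suc n) = refl
≡ᵇ-sym (suc m) zero    = refl
≡ᵇ-sym (suc m) (suc n) = ≡ᵇ-sym m n

>⇒≡ᵇ-false : ∀ {m n} → n < m → (m ≡ᵇ n) ≡ false
>⇒≡ᵇ-false {suc m} {zero}  _       = refl
>⇒≡ᵇ-false {suc m} {suc n} (s≤s p) = >⇒≡ᵇ-false p

<ᵇ-suc-split : ∀ c n → ⟦ c <ᵇ suc n ⟧ ≡ ⟦ c <ᵇ n ⟧ + ⟦ n ≡ᵇ c ⟧
<ᵇ-suc-split zero    zero    = refl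
<ᵇ-suc-split zero    (suc n) = refl
<ᵇ-suc-split (suc c) zero    = refl
<ᵇ-suc-split (suc c) (suc n) = <ᵇ-suc-split c n

∸-≡ᵇ : ∀ j x h → j ≤ x → (x ∸ j ≡ᵇ h) ≡ (h + j ≡ᵇ x)
∸-≡ᵇ zero    x       h _ rewrite +-identityʳ h = ≡ᵇ-sym x h
∸-≡ᵇ (suc j) (suc x) h (s≤s p) rewrite +-suc h j = ∸-≡ᵇ j x h p

∨-≡ᵇ-suc : ∀ a h → ⟦ (a ≡ᵇ h) ∨ (a ≡ᵇ suc h) ⟧ ≡ ⟦ a ≡ᵇ h ⟧ + ⟦ a ≡ᵇ suc h ⟧
∨-≡ᵇ-suc zero          zero    = refl
∨-≡ᵇ-suc zero          (suc h) = refl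
∨-≡ᵇ-suc (suc zero)    zero    = refl
∨-≡ᵇ-suc (suc (suc a)) zero    = refl
∨-≡ᵇ-suc (suc a)       (suc h) = ∨-≡ᵇ-suc a h

count-cong : ∀ {p q : ℕ → Bool} M → (∀ j → j < M → p (suc j) ≡ q (suc j)) → count p M ≡ count q M
count-cong zero    _  = refl
count-cong (suc M) eq = cong₂ _+_ (count-cong M (λ j j<M → eq j (m<n⇒m<1+n j<M))) (cong ⟦_⟧ (eq M ≤-refl))

count-shift : ∀ (p : ℕ → Bool) M → count p (suc M) ≡ ⟦ p 1 ⟧ + count (p ∘ suc) M
count-shift p zero    = sym (+-identityʳ _)
count-shift p (suc M) = trans (cong (_+ ⟦ p (suc (suc M)) ⟧) (count-shift p M)) (+-assoc ⟦ p 1 ⟧ _ _)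

+-interchange : ∀ a b c d → (a + b) + (c + d) ≡ (a + c) + (b + d)
+-interchange = solve-∀

count-+ : ∀ {p q r : ℕ → Bool} M → (∀ j → j < M → ⟦ p (suc j) ⟧ ≡ ⟦ q (suc j) ⟧ + ⟦ r (suc j) ⟧) →
          count p M ≡ count q M + count r M
count-+ zero    _  = refl
count-+ {p} {q} {r} (suc M) eq =
  trans (cong₂ _+_ (count-+ {p} {q} {r} M (λ j j<M → eq j (m<n⇒m<1+n j<M))) (eq M ≤-refl))
        (+-interchange (count q M) (count r M) _ _)

-- Partitions with a bound on the first part

data Part : ℕ → List ℕ → Set where
  []  : ∀ {b} → Part b []
  _∷_ : ∀ {b x xs} → suc x ≤ b → Part (suc x) xs → Part b (suc x ∷ xs)

weaken : ∀ {a b γ} → a ≤ b → Part a γ → Part b γ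
weaken a≤b []      = []
weaken a≤b (p ∷ P) = ≤-trans p a≤b ∷ P

conjAt-> : ∀ {b γ j} → Part b γ → b < j → conjAt γ j ≡ 0
conjAt-> [] _ = refl
conjAt-> {j = suc j} (p ∷ P) (s≤s b≤j)
  rewrite ≥⇒<ᵇ-false (≤-trans p b≤j) = conjAt-> P (s≤s (≤-trans p b≤j))

conjAt-1 : ∀ {b γ} → Part b γ → conjAt γ 1 ≡ length γ
conjAt-1 []      = refl
conjAt-1 (p ∷ P) = cong suc (conjAt-1 P)

-- Walk along the boundary of γ from (0, ℓ(γ)) to (M, 0). The anti-diagonal
-- index goes up along a column step and down along a row step; counting the
-- steps between levels c - 1 and c in both directions gives `crossing`.

rowsOn : ℕ → List ℕ → ℕ
rowsOn zero    _        = 0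
rowsOn (suc c) []       = 0
rowsOn (suc c) (x ∷ xs) = ⟦ x ≡ᵇ c ⟧ + rowsOn c xs

-- Column j climbs to level γ'_j + j. Dually, `rowsOn c` counts the rows with γ_i + i = c; lowering
-- c at each row accounts for the i.
colsOn : ℕ → List ℕ → ℕ → ℕ
colsOn c γ M = count (λ j → conjAt γ j + j ≡ᵇ c) M

colsOn-0 : ∀ γ M → colsOn 0 γ M ≡ 0
colsOn-0 γ zero    = refl
colsOn-0 γ (suc M) rewrite colsOn-0 γ M | +-suc (conjAt γ (suc M)) M = refl

colsOn-[] : ∀ c M → colsOn (suc c) [] M ≡ ⟦ c <ᵇ M ⟧
colsOn-[] c zero    = refl
colsOn-[] c (suc M) = trans (cong (_+ ⟦ M ≡ᵇ c ⟧) (colsOn-[] c M)) (sym (<ᵇ-suc-split c M))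

colsOn-∷-top : ∀ c x xs → colsOn (suc c) (x ∷ xs) x ≡ colsOn c xs x
colsOn-∷-top c x xs = count-cong x go
  where
  go : ∀ j → j < x → (conjAt (x ∷ xs) (suc j) + suc j ≡ᵇ suc c) ≡ (conjAt xs (suc j) + suc j ≡ᵇ c)
  go j j<x rewrite <⇒<ᵇ-true j<x = refl

-- The columns past `x` are empty, so column j sits on level j and they add 1 exactly when x ≤ c < d
-- + x. This is a difference of two indicators, with the negative one moved to the left.
colsOn-∷ : ∀ c {x xs} d → Part x xs →
           colsOn (suc c) (x ∷ xs) (d + x) + ⟦ c <ᵇ x ⟧ ≡ colsOn c xs x + ⟦ c <ᵇ d + x ⟧
colsOn-∷ c {x} {xs} zero    P = cong (_+ ⟦ c <ᵇ x ⟧) (colsOn-∷-top c x xs)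
colsOn-∷ c {x} {xs} (suc d) P = begin
  (A + ⟦ conjAt (x ∷ xs) (suc (d + x)) + suc (d + x) ≡ᵇ suc c ⟧) + ⟦ c <ᵇ x ⟧
    ≡⟨ cong (λ h → A + ⟦ h + suc (d + x) ≡ᵇ suc c ⟧ + ⟦ c <ᵇ x ⟧) beyond ⟩
  (A + e) + ⟦ c <ᵇ x ⟧                 ≡⟨ swap A e _ ⟩
  (A + ⟦ c <ᵇ x ⟧) + e                 ≡⟨ cong (_+ e) (colsOn-∷ c d P) ⟩
  (colsOn c xs x + ⟦ c <ᵇ d + x ⟧) + e ≡⟨ +-assoc (colsOn c xs x) _ _ ⟩
  colsOn c xs x + (⟦ c <ᵇ d + x ⟧ + e) ≡⟨ cong (colsOn c xs x +_) (sym (<ᵇ-suc-split c (d + x))) ⟩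
  colsOn c xs x + ⟦ c <ᵇ suc (d + x) ⟧ ∎
  where
  open ≡-Reasoning
  A = colsOn (suc c) (x ∷ xs) (d + x)
  e = ⟦ d + x ≡ᵇ c ⟧
  swap : ∀ a b c → (a + b) + c ≡ (a + c) + b
  swap = solve-∀
  beyond : conjAt (x ∷ xs) (suc (d + x)) ≡ 0
  beyond rewrite ≥⇒<ᵇ-false (m≤n+m x d) = conjAt-> P (s≤s (m≤n+m x d))

crossing : ∀ c {M γ} → Part M γ →
           colsOn c γ M + ⟦ c ≤ᵇ length γ ⟧ ≡ rowsOn c γ + ⟦ c ≤ᵇ M ⟧
crossing zero    {M} {γ} P = cong (_+ 1) (colsOn-0 γ M)
crossing (suc c) {M} []    = trans (+-identityʳ _) (colsOn-[] c M)
-- Without the first row all levels drop by one and the walk around `xs` may stop at column `x`;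
-- `colsOn-∷` puts the empty columns back.
crossing (suc c) {M} (_∷_ {x = y} {xs = xs} p P) = +-cancelʳ-≡ ⟦ c <ᵇ x ⟧ _ _ (begin
  (U + ⟦ c <ᵇ suc (length xs) ⟧) + ⟦ c <ᵇ x ⟧
    ≡⟨ swap U _ _ ⟩
  (U + ⟦ c <ᵇ x ⟧) + ⟦ c <ᵇ suc (length xs) ⟧
    ≡⟨ cong₂ _+_ step (cong ⟦_⟧ (<ᵇ-suc c (length xs))) ⟩
  (colsOn c xs x + ⟦ c <ᵇ M ⟧) + ⟦ c ≤ᵇ length xs ⟧
    ≡⟨ swap (colsOn c xs x) _ _ ⟩
  (colsOn c xs x + ⟦ c ≤ᵇ length xs ⟧) + ⟦ c <ᵇ M ⟧
    ≡⟨ cong (_+ ⟦ c <ᵇ M ⟧) (crossing c P) ⟩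
  (rowsOn c xs + ⟦ c ≤ᵇ x ⟧) + ⟦ c <ᵇ M ⟧
    ≡⟨ cong (λ e → rowsOn c xs + e + ⟦ c <ᵇ M ⟧) (trans (cong ⟦_⟧ (sym (<ᵇ-suc c x))) (<ᵇ-suc-split c x)) ⟩
  (rowsOn c xs + (⟦ c <ᵇ x ⟧ + ⟦ x ≡ᵇ c ⟧)) + ⟦ c <ᵇ M ⟧
    ≡⟨ rearrange (rowsOn c xs) ⟦ c <ᵇ x ⟧ ⟦ x ≡ᵇ c ⟧ _ ⟩
  ((⟦ x ≡ᵇ c ⟧ + rowsOn c xs) + ⟦ c <ᵇ M ⟧) + ⟦ c <ᵇ x ⟧ ∎)
  where
  open ≡-Reasoning
  x = suc y
  U = colsOn (suc c) (x ∷ xs) M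
  swap : ∀ a b c → (a + b) + c ≡ (a + c) + b
  swap = solve-∀
  rearrange : ∀ a b c d → (a + (b + c)) + d ≡ ((c + a) + d) + b
  rearrange = solve-∀
  step : U + ⟦ c <ᵇ x ⟧ ≡ colsOn c xs x + ⟦ c <ᵇ M ⟧
  step = subst (λ M → colsOn (suc c) (x ∷ xs) M + ⟦ c <ᵇ x ⟧ ≡ colsOn c xs x + ⟦ c <ᵇ M ⟧)
               (m∸n+n≡m p) (colsOn-∷ c (M ∸ x) P)

-- dinv row by row

row : ℕ → List ℕ → ℕ
row x γ = count (cellOK (x ∷ γ) 1 x) x

-- A row added on top raises the columns it covers and the row indices by one alike, so legs do not
-- change.
dinvRows-∷ : ∀ x γ i {b} ys → b ≤ x → Part b ys → dinvRows (x ∷ γ) (suc i) ys ≡ dinvRows γ i ys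
dinvRows-∷ x γ i []       b≤x []      = refl
dinvRows-∷ x γ i (y ∷ ys) b≤x (p ∷ P) =
  cong₂ _+_ (count-cong y same) (dinvRows-∷ x γ (suc i) ys (≤-trans p b≤x) P)
  where
  same : ∀ j → j < y → cellOK (x ∷ γ) (suc i) y (suc j) ≡ cellOK γ i y (suc j)
  same j j<y rewrite <⇒<ᵇ-true (≤-trans j<y (≤-trans p b≤x)) = refl

dinv-∷ : ∀ {x γ} → Part x γ → dinv (x ∷ γ) ≡ row x γ + dinv γ
dinv-∷ {x} {γ} P = cong (row x γ +_) (dinvRows-∷ x γ 1 γ ≤-refl P)

-- In a top row of length x, column j has leg γ'_j and arm x - j, so arm - leg is 0 or 1 exactly
-- when γ'_j + j is x or x - 1.
row-suc : ∀ y γ → row (suc y) γ ≡ colsOn (suc y) γ (suc y) + colsOn y γ (suc y)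
row-suc y γ = count-+ {cellOK (suc y ∷ γ) 1 (suc y)} (suc y) go
  where
  go : ∀ j → j < suc y → ⟦ cellOK (suc y ∷ γ) 1 (suc y) (suc j) ⟧ ≡
       ⟦ conjAt γ (suc j) + suc j ≡ᵇ suc y ⟧ + ⟦ conjAt γ (suc j) + suc j ≡ᵇ y ⟧
  go j j<x rewrite <⇒<ᵇ-true j<x =
    trans (∨-≡ᵇ-suc (y ∸ j) (conjAt γ (suc j)))
          (cong₂ _+_ (cong ⟦_⟧ (∸-≡ᵇ (suc j) (suc y) (conjAt γ (suc j)) j<x))
                     (cong ⟦_⟧ (∸-≡ᵇ (suc j) (suc y) (suc (conjAt γ (suc j))) j<x)))

row-rows : ∀ {y γ} → Part (suc y) γ →
           row (suc y) γ + (⟦ suc y ≤ᵇ length γ ⟧ + ⟦ y ≤ᵇ length γ ⟧) ≡ 2 + (rowsOn (suc y) γ + rowsOn y γ)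
row-rows {y} {γ} P = begin
  row (suc y) γ + (a + b)
    ≡⟨ cong (_+ (a + b)) (row-suc y γ) ⟩
  (colsOn (suc y) γ (suc y) + colsOn y γ (suc y)) + (a + b)
    ≡⟨ +-interchange (colsOn (suc y) γ (suc y)) _ _ _ ⟩
  (colsOn (suc y) γ (suc y) + a) + (colsOn y γ (suc y) + b)
    ≡⟨ cong₂ _+_ (crossing (suc y) P) (crossing y P) ⟩
  (rowsOn (suc y) γ + ⟦ suc y ≤ᵇ suc y ⟧) + (rowsOn y γ + ⟦ y ≤ᵇ suc y ⟧)
    ≡⟨ cong₂ (λ u v → (rowsOn (suc y) γ + ⟦ u ⟧) + (rowsOn y γ + ⟦ v ⟧)) (≤⇒≤ᵇ-true {suc y} ≤-refl) (≤⇒≤ᵇ-true (n≤1+n y)) ⟩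
  (rowsOn (suc y) γ + 1) + (rowsOn y γ + 1)
    ≡⟨ shuffle (rowsOn (suc y) γ) _ ⟩
  2 + (rowsOn (suc y) γ + rowsOn y γ) ∎
  where
  open ≡-Reasoning
  a = ⟦ suc y ≤ᵇ length γ ⟧
  b = ⟦ y ≤ᵇ length γ ⟧
  shuffle : ∀ u v → (u + 1) + (v + 1) ≡ 2 + (u + v)
  shuffle = solve-∀

-- Deleting the first column

dec : List ℕ → List ℕ
dec (suc (suc x) ∷ xs) = suc x ∷ dec xs
-- In a partition a leading 1 is followed only by 1s, which all vanish with the column.
dec _                  = []

dec-ones : ∀ {γ} → Part 1 γ → dec γ ≡ []
dec-ones []            = refl
dec-ones (s≤s z≤n ∷ _) = refl

dec-part : ∀ {b γ} → Part (suc b) γ → Part b (dec γ)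
dec-part []                             = []
dec-part (_∷_ {x = zero}  p       P)    = []
dec-part (_∷_ {x = suc x} (s≤s p) P)    = p ∷ dec-part P

sum-dec : ∀ {b γ} → Part b γ → length γ + sum (dec γ) ≡ sum γ
sum-dec [] = refl
sum-dec (_∷_ {x = zero} {xs} p P) =
  cong suc (trans (cong (λ δ → length xs + sum δ) (sym (dec-ones P))) (sum-dec P))
sum-dec (_∷_ {x = suc x} {xs} p P) =
  cong suc (trans (shuffle (length xs) x _) (cong (suc x +_) (sum-dec P)))
  where
  shuffle : ∀ a b c → a + (suc b + c) ≡ suc b + (a + c)
  shuffle = solve-∀

conjAt-dec : ∀ {b γ} j → Part b γ → conjAt (dec γ) (suc j) ≡ conjAt γ (suc (suc j))
conjAt-dec j []                       = refl
conjAt-dec j (_∷_ {x = zero}  p P)    = sym (conjAt-> P (s≤s (s≤s z≤n)))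
conjAt-dec j (_∷_ {x = suc x} p P)    = cong (⟦ j <ᵇ suc x ⟧ +_) (conjAt-dec j P)

colsOn-dec : ∀ {b γ} c M → Part b γ →
             colsOn (suc c) γ (suc M) ≡ ⟦ length γ ≡ᵇ c ⟧ + colsOn c (dec γ) M
colsOn-dec {γ = γ} c M P = trans (count-shift (λ j → conjAt γ j + j ≡ᵇ suc c) M) (cong₂ _+_ first rest)
  where
  first : ⟦ conjAt γ 1 + 1 ≡ᵇ suc c ⟧ ≡ ⟦ length γ ≡ᵇ c ⟧
  first rewrite conjAt-1 P | +-comm (length γ) 1 = refl
  rest : count (λ j → conjAt γ (suc j) + suc j ≡ᵇ suc c) M ≡ colsOn c (dec γ) M
  rest = count-cong M λ j _ → cong (_≡ᵇ suc c)
    (trans (+-suc (conjAt γ (suc (suc j))) (suc j)) (cong (λ h → suc (h + suc j)) (sym (conjAt-dec j P))))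

-- The first cell of the row has arm `y` and leg `length γ`; the others move one column left and
-- keep both.
row-dec : ∀ {b γ} y → Part b γ →
          row (suc y) γ ≡ (⟦ y ≡ᵇ length γ ⟧ + ⟦ y ≡ᵇ suc (length γ) ⟧) + row y (dec γ)
row-dec {γ = γ} zero P = begin
  row 1 γ                              ≡⟨ row-suc 0 γ ⟩
  colsOn 1 γ 1 + colsOn 0 γ 1          ≡⟨ cong₂ _+_ (colsOn-dec 0 0 P) (colsOn-0 γ 1) ⟩
  (⟦ length γ ≡ᵇ 0 ⟧ + 0) + 0          ≡⟨ cong (λ b → ⟦ b ⟧ + 0 + 0) (≡ᵇ-sym (length γ) 0) ⟩
  (⟦ 0 ≡ᵇ length γ ⟧ + 0) + 0          ∎
  where open ≡-Reasoning
row-dec {γ = γ} (suc y) P = begin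
  row (2 + y) γ
    ≡⟨ row-suc (suc y) γ ⟩
  colsOn (2 + y) γ (2 + y) + colsOn (1 + y) γ (2 + y)
    ≡⟨ cong₂ _+_ (colsOn-dec (suc y) (suc y) P) (colsOn-dec y (suc y) P) ⟩
  (⟦ L ≡ᵇ suc y ⟧ + u) + (⟦ L ≡ᵇ y ⟧ + v)
    ≡⟨ +-interchange ⟦ L ≡ᵇ suc y ⟧ u _ _ ⟩
  (⟦ L ≡ᵇ suc y ⟧ + ⟦ L ≡ᵇ y ⟧) + (u + v)
    ≡⟨ cong₂ _+_ (cong₂ (λ a b → ⟦ a ⟧ + ⟦ b ⟧) (≡ᵇ-sym L (suc y)) (≡ᵇ-sym L y)) (sym (row-suc y (dec γ))) ⟩
  (⟦ suc y ≡ᵇ L ⟧ + ⟦ y ≡ᵇ L ⟧) + row (suc y) (dec γ) ∎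
  where
  open ≡-Reasoning
  L = length γ
  u = colsOn (suc y) (dec γ) (suc y)
  v = colsOn y (dec γ) (suc y)

dinv-dec-∷ : ∀ {y γ} → Part (suc y) γ → row y (dec γ) + dinv (dec γ) ≡ dinv (dec (suc y ∷ γ))
dinv-dec-∷ {zero}  P = cong dinv (dec-ones P)
dinv-dec-∷ {suc y} P = sym (dinv-∷ (dec-part P))

-- Row i meets the first column in a cell with arm γ_i - 1 and leg ℓ(γ) - i, which counts exactly
-- when γ_i + i is ℓ(γ)+1 or ℓ(γ)+2.
dinv-dec : ∀ {b γ} → Part b γ →
           dinv γ ≡ (rowsOn (suc (length γ)) γ + rowsOn (2 + length γ) γ) + dinv (dec γ)
dinv-dec [] = refl
dinv-dec (_∷_ {x = y} {xs} p P) = begin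
  dinv (suc y ∷ xs)
    ≡⟨ dinv-∷ P ⟩
  row (suc y) xs + dinv xs
    ≡⟨ cong₂ _+_ (row-dec y P) (dinv-dec P) ⟩
  ((a + b) + row y (dec xs)) + ((c + d) + dinv (dec xs))
    ≡⟨ shuffle a b c d _ _ ⟩
  ((a + c) + (b + d)) + (row y (dec xs) + dinv (dec xs))
    ≡⟨ cong (((a + c) + (b + d)) +_) (dinv-dec-∷ P) ⟩
  ((a + c) + (b + d)) + dinv (dec (suc y ∷ xs)) ∎
  where
  open ≡-Reasoning
  a = ⟦ y ≡ᵇ length xs ⟧
  b = ⟦ y ≡ᵇ suc (length xs) ⟧
  c = rowsOn (suc (length xs)) xs
  d = rowsOn (2 + length xs) xs
  shuffle : ∀ a b c d e f → ((a + b) + e) + ((c + d) + f) ≡ ((a + c) + (b + d)) + (e + f)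
  shuffle = solve-∀

-- The map ν

-- The bound is the domain condition of `ν` and lets the walk end at column ℓ(γ)+2. In `u≡` the
-- surplus column survives; in `v≡` it is the deleted first column.
dinv-ν : ∀ {γ} → Part (2 + length γ) γ → dinv (suc (length γ) ∷ dec γ) ≡ suc (dinv γ)
dinv-ν {γ} P = begin
  dinv (suc L ∷ dec γ)
    ≡⟨ dinv-∷ (dec-part P) ⟩
  row (suc L) (dec γ) + dinv (dec γ)
    ≡⟨ cong (_+ dinv (dec γ)) (row-suc L (dec γ)) ⟩
  (u + v) + dinv (dec γ)
    ≡⟨ cong₂ (λ a b → (a + b) + dinv (dec γ)) u≡ v≡ ⟩
  (suc (rowsOn (2 + L) γ) + rowsOn (suc L) γ) + dinv (dec γ)
    ≡⟨ cong (λ a → suc a + dinv (dec γ)) (+-comm (rowsOn (2 + L) γ) _) ⟩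
  suc ((rowsOn (suc L) γ + rowsOn (2 + L) γ) + dinv (dec γ))
    ≡⟨ cong suc (sym (dinv-dec P)) ⟩
  suc (dinv γ) ∎
  where
  open ≡-Reasoning
  L = length γ
  u = colsOn (suc L) (dec γ) (suc L)
  v = colsOn L (dec γ) (suc L)
  u≡ : u ≡ suc (rowsOn (2 + L) γ)
  u≡ = begin
    u                                           ≡⟨ cong (λ b → ⟦ b ⟧ + u) (trans (≡ᵇ-sym L (suc L)) (>⇒≡ᵇ-false (≤-refl {suc L}))) ⟨
    ⟦ L ≡ᵇ suc L ⟧ + u                          ≡⟨ colsOn-dec (suc L) (suc L) P ⟨
    colsOn (2 + L) γ (2 + L)                    ≡⟨ +-identityʳ _ ⟨
    colsOn (2 + L) γ (2 + L) + 0                ≡⟨ cong (λ b → colsOn (2 + L) γ (2 + L) + ⟦ b ⟧) (≥⇒<ᵇ-false (n≤1+n L)) ⟨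
    colsOn (2 + L) γ (2 + L) + ⟦ 2 + L ≤ᵇ L ⟧   ≡⟨ crossing (2 + L) P ⟩
    rowsOn (2 + L) γ + ⟦ 2 + L ≤ᵇ 2 + L ⟧       ≡⟨ cong (λ b → rowsOn (2 + L) γ + ⟦ b ⟧) (≤⇒≤ᵇ-true {2 + L} ≤-refl) ⟩
    rowsOn (2 + L) γ + 1                        ≡⟨ +-comm _ 1 ⟩
    suc (rowsOn (2 + L) γ)                      ∎
  v≡ : v ≡ rowsOn (suc L) γ
  v≡ = suc-injective (begin
    suc v                                       ≡⟨ cong (λ b → ⟦ b ⟧ + v) (≡ᵇ-refl L) ⟨
    ⟦ L ≡ᵇ L ⟧ + v                              ≡⟨ colsOn-dec L (suc L) P ⟨
    colsOn (suc L) γ (2 + L)                    ≡⟨ +-identityʳ _ ⟨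
    colsOn (suc L) γ (2 + L) + 0                ≡⟨ cong (λ b → colsOn (suc L) γ (2 + L) + ⟦ b ⟧) (≥⇒<ᵇ-false (≤-refl {L})) ⟨
    colsOn (suc L) γ (2 + L) + ⟦ suc L ≤ᵇ L ⟧   ≡⟨ crossing (suc L) P ⟩
    rowsOn (suc L) γ + ⟦ suc L ≤ᵇ 2 + L ⟧       ≡⟨ cong (λ b → rowsOn (suc L) γ + ⟦ b ⟧) (≤⇒≤ᵇ-true (n≤1+n (suc L))) ⟩
    rowsOn (suc L) γ + 1                        ≡⟨ +-comm _ 1 ⟩
    suc (rowsOn (suc L) γ)                      ∎)

strip-suc : ∀ x xs → strip (suc x ∷ xs) ≡ suc x ∷ strip xs
strip-suc x xs with strip xs
... | []    = refl
... | _ ∷ _ = refl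

strip-0 : ∀ xs → strip xs ≡ [] → strip (0 ∷ xs) ≡ []
strip-0 xs eq rewrite eq = refl

strip-pred : ∀ {b γ} → Part b γ → strip (map (λ y → y ∸ 1) γ) ≡ dec γ
strip-pred [] = refl
strip-pred (_∷_ {x = zero}  {xs} p P) = strip-0 (map (λ y → y ∸ 1) xs) (trans (strip-pred P) (dec-ones P))
strip-pred (_∷_ {x = suc x} {xs} p P) = trans (strip-suc x (map (λ y → y ∸ 1) xs)) (cong (suc x ∷_) (strip-pred P))

ν-dec : ∀ {γ} → Part (2 + length γ) γ → ν γ ≡ just (suc (length γ) ∷ dec γ)
ν-dec [] = refl
ν-dec {γ@(suc x ∷ xs)} P@(p ∷ _)
  rewrite ≤⇒≤ᵇ-true (subst (suc x ≤_) (+-comm 2 (length γ)) p)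
  = cong just (trans (strip-suc (length γ) (map (λ y → y ∸ 1) γ)) (cong (suc (length γ) ∷_) (strip-pred P)))

DP-dec : ∀ {b γ} N → Part b γ → length γ ≤ N → DPfrom (suc N) γ → DPfrom N (dec γ)
DP-dec N [] _ _ = tt
DP-dec (suc N) (_∷_ {x = zero}  p P) _ _ = tt
DP-dec (suc N) (_∷_ {x = suc x} p P) (s≤s L≤N) (s≤s x≤N , D) = x≤N , DP-dec N P L≤N D

-- The initial objects 𝕀

tri : ℕ → ℕ
tri zero    = 0
tri (suc n) = suc n + tri n

stair : ℕ → ℕ → List ℕ
stair zero    r       = []
stair (suc l) zero    = suc l ∷ stair l zero
stair (suc l) (suc r) = suc (suc l) ∷ stair l r

applyUpTo-stair : ∀ (f : ℕ → ℕ) l r → (∀ t → f t ≡ l ∸ t + ⟦ t <ᵇ r ⟧) → applyUpTo f l ≡ stair l r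
applyUpTo-stair f zero    r       eq = refl
applyUpTo-stair f (suc l) zero    eq =
  cong₂ _∷_ (trans (eq 0) (+-identityʳ _)) (applyUpTo-stair (f ∘ suc) l zero (eq ∘ suc))
applyUpTo-stair f (suc l) (suc r) eq =
  cong₂ _∷_ (trans (eq 0) (+-comm _ 1)) (applyUpTo-stair (f ∘ suc) l r (eq ∘ suc))

block : ℕ → ℕ → ℕ → List ℕ
block a l r = replicate a (suc l) ++ stair l r

𝕀-block : ∀ k l → 𝕀 k (suc l) ≡ block (suc (k / suc l)) l (k % suc l)
𝕀-block k l = cong (replicate (suc (k / suc l)) (suc l) ++_)
  (applyUpTo-stair (λ t → (suc l ∸ suc t) + (if suc t ≤ᵇ (k % suc l) then 1 else 0)) l (k % suc l) (λ t → refl))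

stair-part : ∀ l r → Part (suc l) (stair l r)
stair-part zero    r       = []
stair-part (suc l) zero    = n≤1+n _ ∷ stair-part l zero
stair-part (suc l) (suc r) = ≤-refl ∷ weaken (n≤1+n _) (stair-part l r)

block-part : ∀ a l r → Part (suc l) (block a l r)
block-part zero    l r = stair-part l r
block-part (suc a) l r = ≤-refl ∷ block-part a l r

length-stair : ∀ l r → length (stair l r) ≡ l
length-stair zero    r       = refl
length-stair (suc l) zero    = cong suc (length-stair l zero)
length-stair (suc l) (suc r) = cong suc (length-stair l r)

length-block : ∀ a l r → length (block a l r) ≡ a + l
length-block zero    l r = length-stair l r
length-block (suc a) l r = cong suc (length-block a l r)

sum-stair : ∀ {l r} → r ≤ l → sum (stair l r) ≡ r + tri l
sum-stair {zero}  z≤n = refl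
sum-stair {suc l} z≤n = cong (suc l +_) (sum-stair {l} z≤n)
sum-stair {suc l} (s≤s {m = r} r≤l) = trans (cong (2 + l +_) (sum-stair r≤l)) (shuffle l r (tri l))
  where
  shuffle : ∀ l r t → 2 + l + (r + t) ≡ suc r + (suc l + t)
  shuffle = solve-∀

sum-block : ∀ a {l r} → r ≤ l → sum (block a l r) ≡ a * suc l + (r + tri l)
sum-block zero    r≤l = sum-stair r≤l
sum-block (suc a) {l} r≤l = trans (cong (suc l +_) (sum-block a r≤l)) (sym (+-assoc (suc l) (a * suc l) _))

-- For r ≤ l, row i of `stair l r` has γ_i + i = l + 2 if i ≤ r and l + 1 otherwise; no row lies
-- lower.
rowsOn-stair-low : ∀ {c} l r → c ≤ l → rowsOn c (stair l r) ≡ 0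
rowsOn-stair-low l       r       z≤n       = refl
rowsOn-stair-low (suc l) zero    (s≤s c≤l)
  rewrite >⇒≡ᵇ-false (s≤s c≤l) = rowsOn-stair-low l zero c≤l
rowsOn-stair-low (suc l) (suc r) (s≤s c≤l)
  rewrite >⇒≡ᵇ-false (m<n⇒m<1+n (s≤s c≤l)) = rowsOn-stair-low l r c≤l

rowsOn-stair-mid : ∀ {l r} → r ≤ l → r + rowsOn (suc l) (stair l r) ≡ l
rowsOn-stair-mid {zero}  z≤n = refl
rowsOn-stair-mid {suc l} z≤n rewrite ≡ᵇ-refl l = cong suc (rowsOn-stair-mid {l} z≤n)
rowsOn-stair-mid {suc l} (s≤s r≤l) rewrite >⇒≡ᵇ-false (≤-refl {suc l}) = cong suc (rowsOn-stair-mid r≤l)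

rowsOn-stair-high : ∀ {l r} → r ≤ l → rowsOn (2 + l) (stair l r) ≡ r
rowsOn-stair-high {zero}  z≤n = refl
rowsOn-stair-high {suc l} z≤n
  rewrite trans (≡ᵇ-sym l (suc l)) (>⇒≡ᵇ-false (≤-refl {suc l})) = rowsOn-stair-high {l} z≤n
rowsOn-stair-high {suc l} (s≤s r≤l) rewrite ≡ᵇ-refl l = cong suc (rowsOn-stair-high r≤l)

rowsOn-block-low : ∀ {c} a l r → c ≤ l → rowsOn c (block a l r) ≡ 0
rowsOn-block-low {zero}  a       l r _ = refl
rowsOn-block-low {suc c} zero    l r c<l = rowsOn-stair-low l r c<l
rowsOn-block-low {suc c} (suc a) l r c<l
  rewrite >⇒≡ᵇ-false {suc l} {c} (m<n⇒m<1+n c<l) = rowsOn-block-low a l r (<⇒≤ c<l)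

row-stair-same : ∀ {l r} → r ≤ l → r + row (suc l) (stair l r) ≡ suc l
row-stair-same {l} {r} r≤l with row-rows (stair-part l r)
... | eq rewrite length-stair l r | ≥⇒<ᵇ-false (≤-refl {l}) | ≤⇒≤ᵇ-true (≤-refl {l})
               | rowsOn-stair-low l r ≤-refl = suc-injective (begin
  suc (r + row (suc l) (stair l r))         ≡⟨ shuffle₁ r _ ⟩
  r + (row (suc l) (stair l r) + 1)         ≡⟨ cong (r +_) eq ⟩
  r + (2 + (rowsOn (suc l) (stair l r) + 0)) ≡⟨ shuffle₂ r _ ⟩
  2 + (r + rowsOn (suc l) (stair l r))      ≡⟨ cong (2 +_) (rowsOn-stair-mid r≤l) ⟩
  2 + l                                     ∎)
  where
  open ≡-Reasoning
  shuffle₁ : ∀ a b → suc (a + b) ≡ a + (b + 1)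
  shuffle₁ = solve-∀
  shuffle₂ : ∀ a b → a + (2 + (b + 0)) ≡ 2 + (a + b)
  shuffle₂ = solve-∀

row-stair-next : ∀ {l r} → r ≤ l → row (2 + l) (stair l r) ≡ 2 + l
row-stair-next {l} {r} r≤l with row-rows (weaken (n≤1+n _) (stair-part l r))
... | eq rewrite length-stair l r | ≥⇒<ᵇ-false (n≤1+n l) | ≥⇒<ᵇ-false (≤-refl {l})
               | rowsOn-stair-high r≤l | rowsOn-stair-mid r≤l = trans (sym (+-identityʳ _)) eq

-- Every cell counts: the value is the size found in `sum-stair`.
dinv-stair : ∀ {l r} → r ≤ l → dinv (stair l r) ≡ r + tri l
dinv-stair {zero}  z≤n = refl
dinv-stair {suc l} z≤n =
  trans (dinv-∷ (stair-part l 0)) (cong₂ _+_ (row-stair-same {l} z≤n) (dinv-stair {l} z≤n))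
dinv-stair {suc l} (s≤s {m = r} r≤l) =
  trans (dinv-∷ (weaken (n≤1+n _) (stair-part l r)))
        (trans (cong₂ _+_ (row-stair-next r≤l) (dinv-stair r≤l)) (shuffle l r (tri l)))
  where
  shuffle : ∀ l r t → 2 + l + (r + t) ≡ suc r + (suc l + t)
  shuffle = solve-∀

-- Above another row of length `suc l`, every cell of the new row has a leg longer than its arm.
row-block : ∀ a l r → row (suc l) (block (suc a) l r) ≡ 0
row-block a l r with row-rows (block-part (suc a) l r)
... | eq rewrite length-block a l r
               | <⇒<ᵇ-true (s≤s (m≤n+m l a)) | ≤⇒≤ᵇ-true (m≤n+m l (suc a))
               | rowsOn-block-low (suc a) l r (≤-refl {l})
               | >⇒≡ᵇ-false (≤-refl {suc l}) | rowsOn-block-low a l r (≤-refl {l})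
  = +-cancelʳ-≡ 2 _ 0 eq

-- The lowest row of length `suc l` counts only `suc l ∸ r` cells, which offsets the `r` raised
-- cells of the stair; the rows above it add nothing. So the value depends on ℓ alone.
dinv-block : ∀ a {l r} → r ≤ l → dinv (block (suc a) l r) ≡ tri (suc l)
dinv-block zero {l} {r} r≤l = begin
  dinv (suc l ∷ stair l r)                     ≡⟨ dinv-∷ (stair-part l r) ⟩
  row (suc l) (stair l r) + dinv (stair l r)   ≡⟨ cong (row (suc l) (stair l r) +_) (dinv-stair r≤l) ⟩
  row (suc l) (stair l r) + (r + tri l)        ≡⟨ shuffle (row (suc l) (stair l r)) r _ ⟩
  (r + row (suc l) (stair l r)) + tri l        ≡⟨ cong (_+ tri l) (row-stair-same r≤l) ⟩
  tri (suc l)                                  ∎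
  where
  open ≡-Reasoning
  shuffle : ∀ a b c → a + (b + c) ≡ (b + a) + c
  shuffle = solve-∀
dinv-block (suc a) {l} {r} r≤l =
  trans (dinv-∷ (block-part (suc a) l r)) (cong₂ _+_ (row-block a l r) (dinv-block a r≤l))

-- The r raised rows end in columns l - r + 2 to l + 1, that is, in the columns `suc j` with l < r +
-- j.
conjAt-stair : ∀ {l r} j → r ≤ l → j ≤ l → j + conjAt (stair l r) (suc j) ≡ l + ⟦ l <ᵇ r + j ⟧
conjAt-stair {zero}  zero z≤n z≤n = refl
conjAt-stair {suc l} {r} j r≤l j≤l with m≤n⇒m<n∨m≡n j≤l
conjAt-stair {suc l} {zero} j r≤l _ | inj₁ (s≤s j≤l)
  rewrite <⇒<ᵇ-true (s≤s j≤l) | +-suc j (conjAt (stair l zero) (suc j)) | conjAt-stair {l} j z≤n j≤l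
        | ≥⇒<ᵇ-false j≤l | ≥⇒<ᵇ-false (m≤n⇒m≤1+n j≤l) = refl
conjAt-stair {suc l} {suc r} j (s≤s r≤l) _ | inj₁ (s≤s j≤l)
  rewrite <⇒<ᵇ-true (m<n⇒m<1+n (s≤s j≤l)) | +-suc j (conjAt (stair l r) (suc j))
  = cong suc (conjAt-stair j r≤l j≤l)
conjAt-stair {suc l} {zero} _ r≤l _ | inj₂ refl
  rewrite ≥⇒<ᵇ-false (≤-refl {suc l}) | conjAt-> (stair-part l zero) (≤-refl {2 + l}) = refl
conjAt-stair {suc l} {suc r} _ (s≤s r≤l) _ | inj₂ refl
  rewrite <⇒<ᵇ-true (≤-refl {2 + l}) | conjAt-> (stair-part l r) (≤-refl {2 + l})
        | <⇒<ᵇ-true (m≤n+m (suc l) r) = refl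

conjAt-block : ∀ a {l r} j → r ≤ l → j ≤ l → j + conjAt (block a l r) (suc j) ≡ a + l + ⟦ l <ᵇ r + j ⟧
conjAt-block zero    j r≤l j≤l = conjAt-stair j r≤l j≤l
conjAt-block (suc a) {l} {r} j r≤l j≤l
  rewrite <⇒<ᵇ-true (s≤s j≤l) | +-suc j (conjAt (block a l r) (suc j)) = cong suc (conjAt-block a j r≤l j≤l)

-- Containment of the initial objects in a staircase

DP-stair⇒ : ∀ {l r t} → r ≤ l → DPfrom (suc l + t) (stair l r) → ⟦ 0 <ᵇ r ⟧ ≤ t
DP-stair⇒ {zero}  z≤n _ = z≤n
DP-stair⇒ {suc l} z≤n _ = z≤n
DP-stair⇒ {suc l} {suc r} {t} _ (p , _) = +-cancelˡ-≤ (suc l) 1 t (subst (_≤ suc l + t) (+-comm 1 (suc l)) p)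

DP-stair⇐ : ∀ l r {t} → ⟦ 0 <ᵇ r ⟧ ≤ t → DPfrom (suc l + t) (stair l r)
DP-stair⇐ zero    r       _ = tt
DP-stair⇐ (suc l) zero    _ = m≤m+n (suc l) _ , DP-stair⇐ l zero z≤n
DP-stair⇐ (suc l) (suc r) {t} p =
  subst (_≤ suc l + t) (+-comm (suc l) 1) (+-monoʳ-≤ (suc l) p) ,
  DP-stair⇐ l r (≤-trans (⟦⟧≤1 (0 <ᵇ r)) p)

-- Of the rows of equal length the lowest is the most constrained; `t` is the room left beside it.
DP-block⇒ : ∀ q {l r N} → DPfrom (suc N) (block (suc q) l r) →
            ∃[ t ] (q + (suc l + t) ≡ N × DPfrom (suc l + t) (stair l r))
DP-block⇒ zero {l} {r} {N} (p , D) =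
  N ∸ suc l , m+[n∸m]≡n p , subst (λ N → DPfrom N (stair l r)) (sym (m+[n∸m]≡n p)) D
DP-block⇒ (suc q) {N = suc N} (p , D) with DP-block⇒ q D
... | t , eq , D′ = t , cong suc eq , D′

DP-block⇐ : ∀ q {l r t} → DPfrom (suc l + t) (stair l r) → DPfrom (suc (q + (suc l + t))) (block (suc q) l r)
DP-block⇐ zero    D = m≤m+n _ _ , D
DP-block⇐ (suc q) {l} {t = t} D =
  ≤-trans (m≤m+n (suc l) t) (m≤n+m (suc l + t) (suc q)) , DP-block⇐ q D

-- The chains

-- The witness `s` also records ℓ ≤ N, which `N ∸ ℓ` would lose when k + m = 0.
Fits : ℕ → ℕ → ℕ → ℕ → Set
Fits k ℓ m N = ∃[ s ] (ℓ + s ≡ N × k + m ≤ ℓ * s)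

-- Here ℓ = `suc l` and k = `r + q * suc l`. At j = 0, `conj` gives the number of parts, hence the
-- next first row; together with `part` it keeps γ in the domain of `ν` while m < ℓ.
record Stage (l q r m : ℕ) (γ : List ℕ) : Set where
  field
    part  : Part (3 + (q + l)) γ
    conj  : ∀ j → j + m ≤ l → j + conjAt γ (suc j) ≡ suc (q + l) + ⟦ l <ᵇ r + (j + m) ⟧
    size  : sum γ ≡ (r + q * suc l) + (tri (suc l) + m)
    dinv≡ : dinv γ ≡ tri (suc l) + m
    dp⇒   : ∀ {N} → DPfrom (suc N) γ → Fits (r + q * suc l) (suc l) m N
    dp⇐   : ∀ {N} → Fits (r + q * suc l) (suc l) m N → DPfrom (suc N) γ

-- With s = q + t, the condition `⟦ 0 <ᵇ r ⟧ ≤ t` left by the rows says ⌈k/ℓ⌉ ≤ s, that is k ≤ ℓs.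
stage-zero : ∀ {l} q {r} → r ≤ l → Stage l q r 0 (block (suc q) l r)
stage-zero {l} q {r} r≤l = record
  { part  = weaken (s≤s (≤-trans (m≤n+m l q) (m≤n+m (q + l) 2))) (block-part (suc q) l r)
  ; conj  = λ j j≤l → trans (conjAt-block (suc q) j r≤l (subst (_≤ l) (+-identityʳ j) j≤l))
                            (cong (λ i → suc (q + l) + ⟦ l <ᵇ r + i ⟧) (sym (+-identityʳ j)))
  ; size  = trans (sum-block (suc q) r≤l) (shuffle l q r (tri l))
  ; dinv≡ = trans (dinv-block q r≤l) (sym (+-identityʳ _))
  ; dp⇒   = to
  ; dp⇐   = from
  }
  where
  shuffle : ∀ l q r t → suc q * suc l + (r + t) ≡ (r + q * suc l) + ((suc l + t) + 0)
  shuffle = solve-∀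
  swap : ∀ q a t → a + (q + t) ≡ q + (a + t)
  swap = solve-∀
  regroup : ∀ l q t → suc l * (q + t) ≡ suc l * t + q * suc l
  regroup = solve-∀
  bound : ∀ {r} t → r ≤ l → ⟦ 0 <ᵇ r ⟧ ≤ t → r ≤ suc l * t
  bound {zero}  t _   _ = z≤n
  bound {suc r} t r≤l p = ≤-trans (m≤n⇒m≤1+n r≤l) (subst (_≤ suc l * t) (*-identityʳ (suc l)) (*-monoʳ-≤ (suc l) p))
  unbound : ∀ r t → r ≤ suc l * t → ⟦ 0 <ᵇ r ⟧ ≤ t
  unbound zero    t       _ = z≤n
  unbound (suc r) (suc t) _ = s≤s z≤n
  unbound (suc r) zero    p with subst (suc r ≤_) (*-zeroʳ (suc l)) p
  ... | ()
  to : ∀ {N} → DPfrom (suc N) (block (suc q) l r) → Fits (r + q * suc l) (suc l) 0 N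
  to D with DP-block⇒ q D
  ... | t , eq , D′ = q + t , trans (swap q (suc l) t) eq ,
    subst (_≤ suc l * (q + t)) (sym (+-identityʳ _))
      (subst (r + q * suc l ≤_) (sym (regroup l q t))
        (+-monoˡ-≤ (q * suc l) (bound t r≤l (DP-stair⇒ r≤l D′))))
  from : ∀ {N} → Fits (r + q * suc l) (suc l) 0 N → DPfrom (suc N) (block (suc q) l r)
  from (s , refl , p) = subst (λ N → DPfrom (suc N) (block (suc q) l r))
      (trans (sym (swap q (suc l) t)) (cong (suc l +_) q+t≡s))
      (DP-block⇐ q (DP-stair⇐ l r (unbound r t r≤)))
    where
    p′ : r + q * suc l ≤ suc l * s
    p′ = subst (_≤ suc l * s) (+-identityʳ _) p
    q≤s : q ≤ s
    q≤s = *-cancelʳ-≤ q s (suc l) (subst (q * suc l ≤_) (*-comm (suc l) s) (≤-trans (m≤n+m (q * suc l) r) p′))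
    t = s ∸ q
    q+t≡s : q + t ≡ s
    q+t≡s = m+[n∸m]≡n q≤s
    r≤ : r ≤ suc l * t
    r≤ = +-cancelʳ-≤ (q * suc l) r (suc l * t)
           (subst (r + q * suc l ≤_) (trans (cong (suc l *_) (sym q+t≡s)) (regroup l q t)) p′)

carry-≤ : ∀ l x → x ≤ l + suc l → x ≤ l + ⟦ l <ᵇ x ⟧ * suc l
carry-≤ l x x≤ with l <? x
... | yes l<x rewrite <⇒<ᵇ-true l<x = subst (x ≤_) (cong (l +_) (sym (*-identityˡ (suc l)))) x≤
... | no  l≮x rewrite ≥⇒<ᵇ-false (≮⇒≥ l≮x) = ≤-trans (≮⇒≥ l≮x) (m≤m+n l _)

carry-≥ : ∀ l x → ⟦ l <ᵇ x ⟧ * suc l ≤ x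
carry-≥ l x with l <? x
... | yes l<x rewrite <⇒<ᵇ-true l<x = subst (_≤ x) (sym (*-identityˡ (suc l))) l<x
... | no  l≮x rewrite ≥⇒<ᵇ-false (≮⇒≥ l≮x) = z≤n

stage-suc : ∀ {l q r m γ} → r ≤ l → m ≤ l → Stage l q r m γ →
            ν γ ≡ just (suc (length γ) ∷ dec γ) × Stage l q r (suc m) (suc (length γ) ∷ dec γ)
stage-suc {l} {q} {r} {m} {γ} r≤l m≤l S = ν-dec P , record
  { part  = s≤s (subst (_≤ 2 + (q + l)) (sym L≡) (subst (_≤ 2 + (q + l)) (+-comm ε (suc (q + l))) (+-monoˡ-≤ (suc (q + l)) (⟦⟧≤1 (l <ᵇ r + m)))))
            ∷ weaken (s≤s low) (dec-part part)
  ; conj  = conj′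
  ; size  = begin
      suc (length γ + sum (dec γ))                     ≡⟨ cong suc (sum-dec P) ⟩
      suc (sum γ)                                      ≡⟨ cong suc size ⟩
      suc ((r + q * suc l) + (tri (suc l) + m))        ≡⟨ +-suc (r + q * suc l) _ ⟨
      (r + q * suc l) + suc (tri (suc l) + m)          ≡⟨ cong ((r + q * suc l) +_) (+-suc (tri (suc l)) m) ⟨
      (r + q * suc l) + (tri (suc l) + suc m)          ∎
  ; dinv≡ = trans (dinv-ν P) (trans (cong suc dinv≡) (sym (+-suc (tri (suc l)) m)))
  ; dp⇒   = to
  ; dp⇐   = from
  }
  where
  open ≡-Reasoning
  open Stage S
  -- The carry of r + m: since r + m < 2ℓ, q + ε is ⌊(k+m)/ℓ⌋.
  ε = ⟦ l <ᵇ r + m ⟧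
  L≡ : length γ ≡ suc (q + l) + ε
  L≡ = trans (sym (conjAt-1 part)) (conj 0 m≤l)
  low : suc (q + l) ≤ length γ
  low = subst (suc (q + l) ≤_) (sym L≡) (m≤m+n _ ε)
  P : Part (2 + length γ) γ
  P = weaken (s≤s (s≤s low)) part
  -- One column is deleted and one cell gained on top, so the old equation at `suc j` becomes the
  -- new one at `j`.
  conj′ : ∀ j → j + suc m ≤ l →
          j + conjAt (suc (length γ) ∷ dec γ) (suc j) ≡ suc (q + l) + ⟦ l <ᵇ r + (j + suc m) ⟧
  conj′ j j≤ rewrite <⇒<ᵇ-true {j} {suc (length γ)} (s≤s (≤-trans (m+n≤o⇒m≤o j j≤) (≤-trans (m≤n+m l (suc q)) low)))
    | conjAt-dec j part | +-suc j (conjAt γ (2 + j)) | +-suc j m = conj (suc j) j≤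
  fill : ∀ l q ε → suc (l + ε * suc l) + q * suc l ≡ suc l * (suc q + ε)
  fill = solve-∀
  move : ∀ r a m → suc (r + m) + a ≡ (r + a) + suc m
  move = solve-∀
  to : ∀ {N} → DPfrom (suc N) (suc (length γ) ∷ dec γ) → Fits (r + q * suc l) (suc l) (suc m) N
  to {N} (p , _) = (suc q + ε) + t , trans (regroup l q ε t) (trans (cong (λ L → suc L + t) (sym L≡)) (m+[n∸m]≡n p)) ,
    ≤-trans (subst (_≤ suc l * (suc q + ε)) (move r (q * suc l) m)
               (subst (suc (r + m) + q * suc l ≤_) (fill l q ε)
                 (+-monoˡ-≤ (q * suc l) (s≤s (carry-≤ l (r + m) (+-mono-≤ r≤l (m≤n⇒m≤1+n m≤l)))))))
            (*-monoʳ-≤ (suc l) (m≤m+n (suc q + ε) t))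
    where
    t = N ∸ suc (length γ)
    regroup : ∀ l q e t → suc l + ((suc q + e) + t) ≡ suc (suc (q + l) + e) + t
    regroup = solve-∀
  -- k + m < ℓs forces q + ε < s, so the first row fits; the rows below it fit because γ does, by
  -- the previous stage.
  from : ∀ {N} → Fits (r + q * suc l) (suc l) (suc m) N → DPfrom (suc N) (suc (length γ) ∷ dec γ)
  from (s , refl , p) = L<N , DP-dec (suc l + s) P (<⇒≤ L<N)
    (dp⇐ (s , refl , ≤-trans (+-monoʳ-≤ (r + q * suc l) (n≤1+n m)) p))
    where
    spill : ∀ l q e → (q + e) * suc l ≡ e * suc l + q * suc l
    spill = solve-∀
    q+ε<s : q + ε < s
    q+ε<s = *-cancelʳ-< (suc l) (q + ε) s (≤-trans
      (s≤s (subst (_≤ r + m + q * suc l) (sym (spill l q ε)) (+-monoˡ-≤ (q * suc l) (carry-≥ l (r + m)))))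
      (subst (suc (r + m) + q * suc l ≤_) (*-comm (suc l) s)
        (subst (_≤ suc l * s) (sym (move r (q * suc l) m)) p)))
    regroup : ∀ l q e → suc (suc (q + l) + e) ≡ suc l + suc (q + e)
    regroup = solve-∀
    L<N : suc (length γ) ≤ suc l + s
    L<N = subst (_≤ suc l + s) (sym (trans (cong suc L≡) (regroup l q ε))) (+-monoʳ-≤ (suc l) q+ε<s)

stages : ∀ {l} q {r} m → r ≤ l → m ≤ suc l →
         ∃[ γ ] (νIter m (block (suc q) l r) ≡ just γ × Stage l q r m γ)
stages q zero    r≤l _ = _ , refl , stage-zero q r≤l
stages q (suc m) r≤l (s≤s m≤l) with stages q m r≤l (m≤n⇒m≤1+n m≤l)
... | γ , eq , S with stage-suc r≤l m≤l S
... | νeq , S′ = _ , trans (cong (_>>= ν) eq) νeq , S′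

record Member (k ℓ m : ℕ) (γ : List ℕ) : Set where
  field
    iter  : νIter m (𝕀 k ℓ) ≡ just γ
    size  : sum γ ≡ k + (tri ℓ + m)
    dinv≡ : dinv γ ≡ tri ℓ + m
    dp⇒   : ∀ {n} → DP n γ → Fits k ℓ m (n ∸ 1)
    dp⇐   : ∀ {n} → Fits k ℓ m (n ∸ 1) → DP n γ

-- Truncated subtraction makes DP 0 agree with DP 1.
DP-0⇒1 : ∀ γ → DP 0 γ → DP 1 γ
DP-0⇒1 []      _ = tt
DP-0⇒1 (x ∷ γ) D = D

DP-1⇒0 : ∀ γ → DP 1 γ → DP 0 γ
DP-1⇒0 []      _ = tt
DP-1⇒0 (x ∷ γ) D = D

member : ∀ k ℓ m → 1 ⊓ k ≤ ℓ → m ≤ ℓ → ∃[ γ ] Member k ℓ m γ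
member zero zero zero _ z≤n = [] , record
  { iter = refl ; size = refl ; dinv≡ = refl
  ; dp⇒ = λ {n} _ → n ∸ 1 , refl , z≤n ; dp⇐ = λ _ → tt }
member (suc k) zero m () _
member k (suc l) m _ m≤ℓ with stages (k / suc l) m (s≤s⁻¹ (m%n<n k (suc l))) m≤ℓ
... | γ , eq , S = γ , record
  { iter  = trans (cong (νIter m) (𝕀-block k l)) eq
  ; size  = trans size (cong (_+ (tri (suc l) + m)) (sym k≡))
  ; dinv≡ = dinv≡
  ; dp⇒   = λ { {zero}  D → subst (λ k → Fits k (suc l) m 0) (sym k≡) (dp⇒ (DP-0⇒1 γ D))
              ; {suc n} D → subst (λ k → Fits k (suc l) m n) (sym k≡) (dp⇒ D) }
  ; dp⇐   = λ { {zero}  F → DP-1⇒0 γ (dp⇐ (subst (λ k → Fits k (suc l) m 0) k≡ F))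
              ; {suc n} F → dp⇐ (subst (λ k → Fits k (suc l) m n) k≡ F) }
  }
  where
  open Stage S
  k≡ : k ≡ k % suc l + k / suc l * suc l
  k≡ = m≡m%n+[m/n]*n k (suc l)

-- Triangular coordinates

tri-mono : ∀ {a b} → a ≤ b → tri a ≤ tri b
tri-mono z≤n     = z≤n
tri-mono (s≤s p) = +-mono-≤ (s≤s p) (tri-mono p)

-- A staircase of side a + b is two smaller staircases and an a × b rectangle; this rectangle is the
-- ℓs of `Fits`.
tri-+ : ∀ a b → tri (a + b) ≡ tri a + (tri b + a * b)
tri-+ zero    b = sym (+-identityʳ _)
tri-+ (suc a) b = trans (cong (suc (a + b) +_) (tri-+ a b)) (shuffle a b (tri a) (tri b))
  where
  shuffle : ∀ a b s t → suc (a + b) + (s + (t + a * b)) ≡ (suc a + s) + (t + suc a * b)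
  shuffle = solve-∀

-- For m ≤ b, tri b + m stays below tri (b + 1).
tri-reflects : ∀ {a b m} → m ≤ b → tri a ≤ tri b + m → a ≤ b
tri-reflects {a} {b} {m} m≤b p with b <? a
... | no  b≮a = ≮⇒≥ b≮a
... | yes b<a = ⊥-elim (<-irrefl refl (≤-trans
      (s≤s (≤-trans p (subst (_≤ b + tri b) (+-comm m (tri b)) (+-monoˡ-≤ (tri b) m≤b)))) (tri-mono b<a)))

tri-coords : ∀ {a b m p} → m ≤ a → p ≤ b → tri a + m ≡ tri b + p → a ≡ b × m ≡ p
tri-coords {a} {b} {m} {p} m≤a p≤b eq with
  ≤-antisym (tri-reflects p≤b (subst (tri a ≤_) eq (m≤m+n _ m)))
            (tri-reflects m≤a (subst (tri b ≤_) (sym eq) (m≤m+n _ p)))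
... | refl = refl , +-cancelˡ-≡ (tri a) m p eq

split : ∀ d → ∃[ ℓ ] ∃[ m ] (m ≤ ℓ × d ≡ tri ℓ + m)
split zero = 0 , 0 , z≤n , refl
split (suc d) with split d
... | ℓ , m , m≤ℓ , eq with m <? ℓ
... | yes m<ℓ = ℓ , suc m , m<ℓ , trans (cong suc eq) (sym (+-suc (tri ℓ) m))
... | no  m≮ℓ with ≤-antisym m≤ℓ (≮⇒≥ m≮ℓ)
... | refl = suc ℓ , 0 , z≤n , cong suc (trans eq (trans (+-comm (tri ℓ) ℓ) (sym (+-identityʳ _))))

nC2≡tri : ∀ n → n C 2 ≡ tri (n ∸ 1)
nC2≡tri zero    = refl
nC2≡tri (suc zero) = refl
nC2≡tri (suc (suc n)) = trans (sym (nCk+nC[k+1]≡[n+1]C[k+1] (suc n) 1))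
                       (cong₂ _+_ (nC1≡n (suc n)) (nC2≡tri (suc n)))

-- Makes the truncated subtraction in `area` exact: the left side is |γ|, the right side n C 2.
Fits-sum : ∀ {k ℓ m N} → Fits k ℓ m N → k + (tri ℓ + m) ≤ tri N
Fits-sum {k} {ℓ} {m} (s , refl , p) = subst (k + (tri ℓ + m) ≤_) (sym (tri-+ ℓ s))
  (subst (_≤ tri ℓ + (tri s + ℓ * s)) (shuffle k (tri ℓ) m) (+-monoʳ-≤ (tri ℓ) (≤-trans p (m≤n+m _ (tri s)))))
  where
  shuffle : ∀ k t m → t + (k + m) ≡ k + (t + m)
  shuffle = solve-∀

-- Writing d = tri ℓ + m and d′ = tri ℓ′ + m′ with k + d + d′ = tri N, Fits says
-- tri (N - ℓ) ≤ d′, that is N ≤ ℓ + ℓ′, which is symmetric in ℓ and ℓ′.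
Fits-opposite : ∀ {k ℓ m ℓ′ m′ N} → m′ ≤ ℓ′ → (k + (tri ℓ + m)) + (tri ℓ′ + m′) ≡ tri N →
                Fits k ℓ m N → Fits k ℓ′ m′ N
Fits-opposite {k} {ℓ} {m} {ℓ′} {m′} {N} m′≤ℓ′ eq (s , refl , p) = N ∸ ℓ′ , m+[n∸m]≡n ℓ′≤N , goal
  where
  s≤ℓ′ : s ≤ ℓ′
  -- Expanding `tri (ℓ + s)` and replacing k + m by the larger ℓs leaves tri s ≤ tri ℓ′ + m′.
  s≤ℓ′ = tri-reflects m′≤ℓ′ (+-cancelʳ-≤ (tri ℓ + ℓ * s) (tri s) (tri ℓ′ + m′)
    (subst (_≤ (tri ℓ′ + m′) + (tri ℓ + ℓ * s)) (trans rearranged (shuffle₂ (tri ℓ) (tri s) (ℓ * s)))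
      (+-monoʳ-≤ (tri ℓ′ + m′) (+-monoʳ-≤ (tri ℓ) p))))
    where
    shuffle₁ : ∀ k t m d → d + (t + (k + m)) ≡ (k + (t + m)) + d
    shuffle₁ = solve-∀
    shuffle₂ : ∀ t u v → t + (u + v) ≡ u + (t + v)
    shuffle₂ = solve-∀
    rearranged : (tri ℓ′ + m′) + (tri ℓ + (k + m)) ≡ tri ℓ + (tri s + ℓ * s)
    rearranged = trans (shuffle₁ k (tri ℓ) m _) (trans eq (tri-+ ℓ s))
  ℓ′≤N : ℓ′ ≤ ℓ + s
  ℓ′≤N = tri-reflects z≤n (subst (tri ℓ′ ≤_) (trans eq (sym (+-identityʳ _)))
           (≤-trans (m≤m+n (tri ℓ′) m′) (m≤n+m _ (k + (tri ℓ + m)))))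
  s′ = ℓ + s ∸ ℓ′
  s′≤ℓ : s′ ≤ ℓ
  s′≤ℓ = m≤n+o⇒m∸n≤o (ℓ + s) ℓ′ (subst (ℓ + s ≤_) (+-comm ℓ ℓ′) (+-monoʳ-≤ ℓ s≤ℓ′))
  balance : (k + m′) + (tri ℓ + m) ≡ tri s′ + ℓ′ * s′
  balance = +-cancelˡ-≡ (tri ℓ′) _ _
    (trans (shuffle k m′ (tri ℓ + m) (tri ℓ′))
           (trans eq (trans (cong tri (sym (m+[n∸m]≡n ℓ′≤N))) (tri-+ ℓ′ s′))))
    where
    shuffle : ∀ k m t u → u + ((k + m) + t) ≡ (k + t) + (u + m)
    shuffle = solve-∀
  goal : k + m′ ≤ ℓ′ * s′
  goal = +-cancelˡ-≤ (tri s′) (k + m′) (ℓ′ * s′) (subst (tri s′ + (k + m′) ≤_) balance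
    (subst (_≤ (k + m′) + (tri ℓ + m)) (+-comm (k + m′) (tri s′))
      (+-monoʳ-≤ (k + m′) (≤-trans (tri-mono s′≤ℓ) (m≤m+n (tri ℓ) m)))))

-- For k > 0 the union starts at ℓ = 1; the exchange cannot land on ℓ = 0, where `Fits` would read k
-- + m ≤ 0.
Fits-index : ∀ {k ℓ m N} → Fits k ℓ m N → 1 ⊓ k ≤ ℓ
Fits-index {zero}              _           = z≤n
Fits-index {suc k} {zero}      (_ , _ , ())
Fits-index {suc k} {suc ℓ}     _           = s≤s z≤n

-- The exchange of area and dinv

inC-member : ∀ {k γ} → InC k γ → ∃[ ℓ ] ∃[ m ] (m ≤ ℓ × Member k ℓ m γ)
inC-member {k} (ℓ , m , low , m≤ℓ , eq) with member k ℓ m low m≤ℓ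
... | δ , M = ℓ , m , m≤ℓ , subst (Member k ℓ m) (just-injective (trans (sym (Member.iter M)) eq)) M

inC-dinv-injective : ∀ {k γ δ} → InC k γ → InC k δ → dinv γ ≡ dinv δ → γ ≡ δ
inC-dinv-injective Cγ Cδ eq with inC-member Cγ | inC-member Cδ
... | ℓ , m , m≤ℓ , M | ℓ′ , m′ , m′≤ℓ′ , M′
  with tri-coords m≤ℓ m′≤ℓ′ (trans (sym (Member.dinv≡ M)) (trans eq (Member.dinv≡ M′)))
... | refl , refl = just-injective (trans (sym (Member.iter M)) (Member.iter M′))

-- The default `[]` makes the function total; in `flip-spec` the iteration is known to succeed.
atDinv : ℕ → ℕ → List ℕ
atDinv k d with split d
... | ℓ , m , _ = fromMaybe [] (νIter m (𝕀 k ℓ))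

flip : ℕ → ℕ → List ℕ → List ℕ
flip k n γ = atDinv k (area n γ)

flip-spec : ∀ {k n γ} → CDP k n γ →
            CDP k n (flip k n γ) × (area n γ ≡ dinv (flip k n γ)) × (dinv γ ≡ area n (flip k n γ))
flip-spec {k} {n} {γ} (Cγ , Dγ) with inC-member Cγ
... | ℓ , m , m≤ℓ , M with split (area n γ)
... | ℓ′ , m′ , m′≤ℓ′ , eq = subst Spec (sym (cong (fromMaybe []) (Member.iter M′)))
  ( ((ℓ′ , m′ , Fits-index F′ , m′≤ℓ′ , Member.iter M′) , Member.dp⇐ M′ F′)
  , trans eq (sym (Member.dinv≡ M′))
  , trans (Member.dinv≡ M) (sym area-δ))
  where
  Spec : List ℕ → Set
  Spec δ = CDP k n δ × (area n γ ≡ dinv δ) × (dinv γ ≡ area n δ)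
  N = n ∸ 1
  F : Fits k ℓ m N
  F = Member.dp⇒ M Dγ
  total : (k + (tri ℓ + m)) + (tri ℓ′ + m′) ≡ tri N
  total = trans (cong ((k + (tri ℓ + m)) +_) (trans (sym eq) (cong₂ _∸_ (nC2≡tri n) (Member.size M))))
                (m+[n∸m]≡n (Fits-sum {k} {ℓ} {m} F))
  F′ : Fits k ℓ′ m′ N
  F′ = Fits-opposite m′≤ℓ′ total F
  δM = member k ℓ′ m′ (Fits-index F′) m′≤ℓ′
  M′ = proj₂ δM
  swap : ∀ k a b → (k + a) + b ≡ a + (k + b)
  swap = solve-∀
  area-δ : area n (proj₁ δM) ≡ tri ℓ + m
  area-δ = trans (cong₂ _∸_ (trans (nC2≡tri n) (trans (sym total) (swap k (tri ℓ + m) _))) (Member.size M′))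
                 (m+n∸n≡m (tri ℓ + m) (k + (tri ℓ′ + m′)))

theorem2p9 : (k n : ℕ) → Opposite n (CDP k n) (CDP k n)
theorem2p9 k n = flip k n , (maps , injective , surjective , exchanges) , unique
  where
  maps : ∀ γ → CDP k n γ → CDP k n (flip k n γ)
  maps γ B = proj₁ (flip-spec B)
  exchanges : ∀ γ → CDP k n γ → (area n γ ≡ dinv (flip k n γ)) × (dinv γ ≡ area n (flip k n γ))
  exchanges γ B = proj₂ (flip-spec B)
  injective : ∀ γ δ → CDP k n γ → CDP k n δ → flip k n γ ≡ flip k n δ → γ ≡ δ
  injective γ δ B D eq = inC-dinv-injective (proj₁ B) (proj₁ D)
    (trans (proj₂ (exchanges γ B)) (trans (cong (area n) eq) (sym (proj₂ (exchanges δ D)))))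
  surjective : ∀ δ → CDP k n δ → ∃[ γ ] (CDP k n γ × flip k n γ ≡ δ)
  -- `flip` is an involution: applied twice it gives a member with the dinv of δ, and dinv
  -- determines the member.
  surjective δ D = flip k n δ , B , inC-dinv-injective (proj₁ (maps _ B)) (proj₁ D)
    (trans (sym (proj₁ (exchanges _ B))) (sym (proj₂ (exchanges δ D))))
    where B = maps δ D
  unique : ∀ h → IsOppMap n (CDP k n) (CDP k n) h → ∀ γ → CDP k n γ → h γ ≡ flip k n γ
  unique h (hmaps , _ , _ , hex) γ B = inC-dinv-injective (proj₁ (hmaps γ B)) (proj₁ (maps γ B))
    (trans (sym (proj₁ (hex γ B))) (proj₁ (exchanges γ B)))
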